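{- Let $D=\mathbb{Z}[\omega]$ with $\omega=\frac{ -1+i\sqrt{3}}{2}$. An element $\alpha\in D$ is a unit of $D$ if and only if $N\alpha=1$. Furthermore, the units of $D$ are exactly $1,-1,\omega,-\omega,\omega^{2},-\omega^{2}$.
   Context: For $\alpha=a+b\omega\in D$ with $a,b\in\mathbb{Z}$, the norm is $N\alpha=\alpha\overline{\alpha}=a^2-ab+b^2$. -}

module Defs where

open import Algebra.Bundles using (CommutativeRing)
open import Algebra.Bundles.Raw using (RawRing)
open import Algebra.Definitions using (Invertible)
open import Algebra.Morphism.Structures using (IsRingMonomorphism)
import Algebra.Properties.Semiring.Exp as Exp
open import Algebra.Structures using (IsCommutativeRing)
open import Data.Integer using (ℤ; +_; 0ℤ; 1ℤ)
import Data.Integer as ℤ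
import Data.Integer.Properties as ℤ
open import Data.Integer.Tactic.RingSolver using (solve-∀)
open import Data.Product using (_,_)
open import Data.Rational using (ℚ; 0ℚ; 1ℚ; ½; -½; toℚᵘ; fromℚᵘ)
import Data.Rational as ℚ
import Data.Rational.Properties as ℚ
import Data.Rational.Solver as ℚSolver
open import Data.Rational.Unnormalised using (ℚᵘ; mkℚᵘ; *≡*)
import Data.Rational.Unnormalised as ℚᵘ
import Data.Rational.Unnormalised.Properties as ℚᵘ
open import Level using (0ℓ)
open import Relation.Binary.PropositionalEquality
  using (_≡_; refl; sym; trans; cong; cong₂; isEquivalence; module ≡-Reasoning)

-- ⟨ a , b ⟩ stands for a + bω.  Every element of ℤ[ω] has exactly one such
-- expression, so propositional equality is the intended equality; ι below
-- is the inclusion into the complex numbers.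
record D : Set where
  constructor ⟨_,_⟩
  field
    coeff₁ : ℤ
    coeffω : ℤ

infixl 6 _+_
infixl 7 _*_
infix  8 -_

_+_ : D → D → D
⟨ a , b ⟩ + ⟨ c , d ⟩ = ⟨ a ℤ.+ c , b ℤ.+ d ⟩

-_ : D → D
- ⟨ a , b ⟩ = ⟨ ℤ.- a , ℤ.- b ⟩

-- Expand (a + bω)(c + dω) and use ω² = -1 - ω.
_*_ : D → D → D
⟨ a , b ⟩ * ⟨ c , d ⟩ =
  ⟨ a ℤ.* c ℤ.- b ℤ.* d , a ℤ.* d ℤ.+ b ℤ.* c ℤ.- b ℤ.* d ⟩

fromℤ : ℤ → D
fromℤ a = ⟨ a , 0ℤ ⟩

0# 1# ω : D
0# = fromℤ 0ℤ
1# = fromℤ 1ℤ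
ω  = ⟨ 0ℤ , 1ℤ ⟩

private
  D-≡ : ∀ {a b c d} → a ≡ c → b ≡ d → ⟨ a , b ⟩ ≡ ⟨ c , d ⟩
  D-≡ = cong₂ ⟨_,_⟩

  *-assoc : ∀ α β γ → (α * β) * γ ≡ α * (β * γ)
  *-assoc ⟨ a , b ⟩ ⟨ c , d ⟩ ⟨ e , f ⟩ = D-≡ (p a b c d e f) (q a b c d e f)
    where
    p : ∀ a b c d e f →
        (a ℤ.* c ℤ.- b ℤ.* d) ℤ.* e ℤ.- (a ℤ.* d ℤ.+ b ℤ.* c ℤ.- b ℤ.* d) ℤ.* f
      ≡ a ℤ.* (c ℤ.* e ℤ.- d ℤ.* f) ℤ.- b ℤ.* (c ℤ.* f ℤ.+ d ℤ.* e ℤ.- d ℤ.* f)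
    p = solve-∀
    q : ∀ a b c d e f →
        (a ℤ.* c ℤ.- b ℤ.* d) ℤ.* f ℤ.+ (a ℤ.* d ℤ.+ b ℤ.* c ℤ.- b ℤ.* d) ℤ.* e
          ℤ.- (a ℤ.* d ℤ.+ b ℤ.* c ℤ.- b ℤ.* d) ℤ.* f
      ≡ a ℤ.* (c ℤ.* f ℤ.+ d ℤ.* e ℤ.- d ℤ.* f) ℤ.+ b ℤ.* (c ℤ.* e ℤ.- d ℤ.* f)
          ℤ.- b ℤ.* (c ℤ.* f ℤ.+ d ℤ.* e ℤ.- d ℤ.* f)
    q = solve-∀

  *-comm : ∀ α β → α * β ≡ β * α
  *-comm ⟨ a , b ⟩ ⟨ c , d ⟩ = D-≡ (p a b c d) (q a b c d)
    where
    p : ∀ a b c d → a ℤ.* c ℤ.- b ℤ.* d ≡ c ℤ.* a ℤ.- d ℤ.* b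
    p = solve-∀
    q : ∀ a b c d → a ℤ.* d ℤ.+ b ℤ.* c ℤ.- b ℤ.* d
                  ≡ c ℤ.* b ℤ.+ d ℤ.* a ℤ.- d ℤ.* b
    q = solve-∀

  *-identityˡ : ∀ α → 1# * α ≡ α
  *-identityˡ ⟨ a , b ⟩ = D-≡ (p a b) (q a b)
    where
    p : ∀ a b → 1ℤ ℤ.* a ℤ.- 0ℤ ℤ.* b ≡ a
    p = solve-∀
    q : ∀ a b → 1ℤ ℤ.* b ℤ.+ 0ℤ ℤ.* a ℤ.- 0ℤ ℤ.* b ≡ b
    q = solve-∀

  *-distribˡ-+ : ∀ α β γ → α * (β + γ) ≡ α * β + α * γ
  *-distribˡ-+ ⟨ a , b ⟩ ⟨ c , d ⟩ ⟨ e , f ⟩ = D-≡ (p a b c d e f) (q a b c d e f)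
    where
    p : ∀ a b c d e f →
        a ℤ.* (c ℤ.+ e) ℤ.- b ℤ.* (d ℤ.+ f)
      ≡ (a ℤ.* c ℤ.- b ℤ.* d) ℤ.+ (a ℤ.* e ℤ.- b ℤ.* f)
    p = solve-∀
    q : ∀ a b c d e f →
        a ℤ.* (d ℤ.+ f) ℤ.+ b ℤ.* (c ℤ.+ e) ℤ.- b ℤ.* (d ℤ.+ f)
      ≡ (a ℤ.* d ℤ.+ b ℤ.* c ℤ.- b ℤ.* d) ℤ.+ (a ℤ.* f ℤ.+ b ℤ.* e ℤ.- b ℤ.* f)
    q = solve-∀

+-*-isCommutativeRing : IsCommutativeRing _≡_ _+_ _*_ -_ 0# 1#
+-*-isCommutativeRing = record
  { isRing = record
    { +-isAbelianGroup = record
      { isGroup = record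
        { isMonoid = record
          { isSemigroup = record
            { isMagma = record { isEquivalence = isEquivalence ; ∙-cong = cong₂ _+_ }
            ; assoc = λ { ⟨ a , b ⟩ ⟨ c , d ⟩ ⟨ e , f ⟩ →
                          D-≡ (ℤ.+-assoc a c e) (ℤ.+-assoc b d f) }
            }
          ; identity = (λ { ⟨ a , b ⟩ → D-≡ (ℤ.+-identityˡ a) (ℤ.+-identityˡ b) })
                     , (λ { ⟨ a , b ⟩ → D-≡ (ℤ.+-identityʳ a) (ℤ.+-identityʳ b) })
          }
        ; inverse = (λ { ⟨ a , b ⟩ → D-≡ (ℤ.+-inverseˡ a) (ℤ.+-inverseˡ b) })
                  , (λ { ⟨ a , b ⟩ → D-≡ (ℤ.+-inverseʳ a) (ℤ.+-inverseʳ b) })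
        ; ⁻¹-cong = cong -_
        }
      ; comm = λ { ⟨ a , b ⟩ ⟨ c , d ⟩ → D-≡ (ℤ.+-comm a c) (ℤ.+-comm b d) }
      }
    ; *-cong = cong₂ _*_
    ; *-assoc = *-assoc
    ; *-identity = *-identityˡ , λ α → trans (*-comm α 1#) (*-identityˡ α)
    ; distrib = *-distribˡ-+
              , λ α β γ → trans (*-comm (β + γ) α)
                  (trans (*-distribˡ-+ α β γ) (cong₂ _+_ (*-comm α β) (*-comm α γ)))
    }
  ; *-comm = *-comm
  }

+-*-commutativeRing : CommutativeRing 0ℓ 0ℓ
+-*-commutativeRing = record { isCommutativeRing = +-*-isCommutativeRing }

open Exp (CommutativeRing.semiring +-*-commutativeRing) public using (_^_)

IsUnit : D → Set
IsUnit = Invertible _≡_ 1# _*_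

-- Complex conjugation: the conjugate of ω is ω² = -1 - ω (see ι-conj).
conj : D → D
conj ⟨ a , b ⟩ = ⟨ a ℤ.- b , ℤ.- b ⟩

N : D → ℤ
N ⟨ a , b ⟩ = a ℤ.* a ℤ.- a ℤ.* b ℤ.+ b ℤ.* b

α*conjα≡Nα : ∀ α → α * conj α ≡ fromℤ (N α)
α*conjα≡Nα ⟨ a , b ⟩ = D-≡ (p a b) (q a b)
  where
  p : ∀ a b → a ℤ.* (a ℤ.- b) ℤ.- b ℤ.* (ℤ.- b) ≡ a ℤ.* a ℤ.- a ℤ.* b ℤ.+ b ℤ.* b
  p = solve-∀
  q : ∀ a b → a ℤ.* (ℤ.- b) ℤ.+ b ℤ.* (a ℤ.- b) ℤ.- b ℤ.* (ℤ.- b) ≡ 0ℤ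
  q = solve-∀

-- The library has no complex numbers, so the identification of ω with
-- (-1 + i√3)/2 is made in the subfield ℚ(i√3) of ℂ: the element x +i√3 y is
-- the complex number x + y·i√3.
module ℚ⟨i√3⟩ where

  infix 5 _+i√3_

  record K : Set where
    constructor _+i√3_
    field
      rat : ℚ
      irr : ℚ

  addK mulK : K → K → K
  addK (x +i√3 y) (u +i√3 v) = (x ℚ.+ u) +i√3 (y ℚ.+ v)
  mulK (x +i√3 y) (u +i√3 v) =
    (x ℚ.* u ℚ.- (+ 3 ℚ./ 1) ℚ.* (y ℚ.* v)) +i√3 (x ℚ.* v ℚ.+ y ℚ.* u)

  negK conjK : K → K
  negK  (x +i√3 y) = (ℚ.- x) +i√3 (ℚ.- y)
  conjK (x +i√3 y) = x +i√3 (ℚ.- y)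

  ωK : K
  ωK = -½ +i√3 ½

  K-rawRing : RawRing 0ℓ 0ℓ
  K-rawRing = record
    { Carrier = K ; _≈_ = _≡_ ; _+_ = addK ; _*_ = mulK ; -_ = negK
    ; 0# = 0ℚ +i√3 0ℚ ; 1# = 1ℚ +i√3 0ℚ }

  ofℤ : ℤ → ℚ
  ofℤ a = a ℚ./ 1

  ι : D → K
  ι ⟨ a , b ⟩ = addK (ofℤ a +i√3 0ℚ) (mulK (ofℤ b +i√3 0ℚ) ωK)

  private
    open ≡-Reasoning
    open ℚSolver.+-*-Solver

    K-≡ : ∀ {x y u v} → x ≡ u → y ≡ v → (x +i√3 y) ≡ (u +i√3 v)
    K-≡ = cong₂ _+i√3_

    -- ι written on rational coefficients.
    κ : ℚ → ℚ → K
    κ x y = addK (x +i√3 0ℚ) (mulK (y +i√3 0ℚ) ωK)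

    toℚᵘ-ofℤ : ∀ a → toℚᵘ (ofℤ a) ℚᵘ.≃ mkℚᵘ a 0
    toℚᵘ-ofℤ a = ℚ.toℚᵘ-fromℚᵘ (mkℚᵘ a 0)

    ofℤ-+ : ∀ a b → ofℤ (a ℤ.+ b) ≡ ofℤ a ℚ.+ ofℤ b
    ofℤ-+ a b = ℚ.toℚᵘ-injective
      (ℚᵘ.≃-trans (toℚᵘ-ofℤ (a ℤ.+ b))
      (ℚᵘ.≃-trans (*≡* (p a b))
      (ℚᵘ.≃-sym (ℚᵘ.≃-trans (ℚ.toℚᵘ-homo-+ (ofℤ a) (ofℤ b))
                             (ℚᵘ.+-cong (toℚᵘ-ofℤ a) (toℚᵘ-ofℤ b))))))
      where
      p : ∀ a b → (a ℤ.+ b) ℤ.* 1ℤ ≡ (a ℤ.* 1ℤ ℤ.+ b ℤ.* 1ℤ) ℤ.* 1ℤ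
      p = solve-∀

    ofℤ-* : ∀ a b → ofℤ (a ℤ.* b) ≡ ofℤ a ℚ.* ofℤ b
    ofℤ-* a b = ℚ.toℚᵘ-injective
      (ℚᵘ.≃-trans (toℚᵘ-ofℤ (a ℤ.* b))
      (ℚᵘ.≃-sym (ℚᵘ.≃-trans (ℚ.toℚᵘ-homo-* (ofℤ a) (ofℤ b))
                             (ℚᵘ.*-cong (toℚᵘ-ofℤ a) (toℚᵘ-ofℤ b)))))

    ofℤ-neg : ∀ a → ofℤ (ℤ.- a) ≡ ℚ.- ofℤ a
    ofℤ-neg a = ℚ.toℚᵘ-injective
      (ℚᵘ.≃-trans (toℚᵘ-ofℤ (ℤ.- a))
      (ℚᵘ.≃-sym (ℚᵘ.≃-trans (ℚ.toℚᵘ-homo‿- (ofℤ a)) (ℚᵘ.-‿cong (toℚᵘ-ofℤ a)))))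

    ofℤ-sub : ∀ a b → ofℤ (a ℤ.- b) ≡ ofℤ a ℚ.- ofℤ b
    ofℤ-sub a b = trans (ofℤ-+ a (ℤ.- b)) (cong (ofℤ a ℚ.+_) (ofℤ-neg b))

    ofℤ-injective : ∀ {a b} → ofℤ a ≡ ofℤ b → a ≡ b
    ofℤ-injective {a} {b} eq
      with ℚ.fromℚᵘ-injective {mkℚᵘ a 0} {mkℚᵘ b 0} eq
    ... | *≡* p = trans (sym (ℤ.*-identityʳ a)) (trans p (ℤ.*-identityʳ b))

    κ-coeffs : ∀ x y → κ x y ≡ (x ℚ.+ y ℚ.* -½ +i√3 y ℚ.* ½)
    κ-coeffs x y = K-≡
      (solve 2 (λ x y → x :+ (y :* con -½ :- con (+ 3 ℚ./ 1) :* (con 0ℚ :* con ½))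
                        := x :+ y :* con -½) refl x y)
      (solve 1 (λ y → con 0ℚ :+ (y :* con ½ :+ con 0ℚ :* con -½) := y :* con ½) refl y)

    κ-+ : ∀ x y u v → κ (x ℚ.+ u) (y ℚ.+ v) ≡ addK (κ x y) (κ u v)
    κ-+ x y u v = begin
      κ (x ℚ.+ u) (y ℚ.+ v)
        ≡⟨ κ-coeffs (x ℚ.+ u) (y ℚ.+ v) ⟩
      ((x ℚ.+ u) ℚ.+ (y ℚ.+ v) ℚ.* -½ +i√3 (y ℚ.+ v) ℚ.* ½)
        ≡⟨ K-≡
          (solve 4 (λ x y u v → (x :+ u) :+ (y :+ v) :* con -½
            := (x :+ y :* con -½) :+ (u :+ v :* con -½)) refl x y u v)
          (solve 2 (λ y v → (y :+ v) :* con ½ := y :* con ½ :+ v :* con ½) refl y v) ⟩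
      addK (x ℚ.+ y ℚ.* -½ +i√3 y ℚ.* ½) (u ℚ.+ v ℚ.* -½ +i√3 v ℚ.* ½)
        ≡⟨ cong₂ addK (κ-coeffs x y) (κ-coeffs u v) ⟨
      addK (κ x y) (κ u v) ∎

    κ-* : ∀ x y u v →
          κ (x ℚ.* u ℚ.- y ℚ.* v) (x ℚ.* v ℚ.+ y ℚ.* u ℚ.- y ℚ.* v)
        ≡ mulK (κ x y) (κ u v)
    κ-* x y u v = begin
      κ (x ℚ.* u ℚ.- y ℚ.* v) (x ℚ.* v ℚ.+ y ℚ.* u ℚ.- y ℚ.* v)
        ≡⟨ κ-coeffs (x ℚ.* u ℚ.- y ℚ.* v) (x ℚ.* v ℚ.+ y ℚ.* u ℚ.- y ℚ.* v) ⟩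
      ((x ℚ.* u ℚ.- y ℚ.* v) ℚ.+ (x ℚ.* v ℚ.+ y ℚ.* u ℚ.- y ℚ.* v) ℚ.* -½
        +i√3 (x ℚ.* v ℚ.+ y ℚ.* u ℚ.- y ℚ.* v) ℚ.* ½)
        ≡⟨ K-≡
          (solve 4 (λ x y u v →
            (x :* u :- y :* v) :+ (x :* v :+ y :* u :- y :* v) :* con -½
            := (x :+ y :* con -½) :* (u :+ v :* con -½)
               :- con (+ 3 ℚ./ 1) :* ((y :* con ½) :* (v :* con ½))) refl x y u v)
          (solve 4 (λ x y u v →
            (x :* v :+ y :* u :- y :* v) :* con ½
            := (x :+ y :* con -½) :* (v :* con ½)
               :+ (y :* con ½) :* (u :+ v :* con -½)) refl x y u v) ⟩
      mulK (x ℚ.+ y ℚ.* -½ +i√3 y ℚ.* ½) (u ℚ.+ v ℚ.* -½ +i√3 v ℚ.* ½)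
        ≡⟨ cong₂ mulK (κ-coeffs x y) (κ-coeffs u v) ⟨
      mulK (κ x y) (κ u v) ∎

    κ-neg : ∀ x y → κ (ℚ.- x) (ℚ.- y) ≡ negK (κ x y)
    κ-neg x y = begin
      κ (ℚ.- x) (ℚ.- y)
        ≡⟨ κ-coeffs (ℚ.- x) (ℚ.- y) ⟩
      ((ℚ.- x) ℚ.+ (ℚ.- y) ℚ.* -½ +i√3 (ℚ.- y) ℚ.* ½)
        ≡⟨ K-≡
          (solve 2 (λ x y → (:- x) :+ (:- y) :* con -½ := :- (x :+ y :* con -½)) refl x y)
          (solve 1 (λ y → (:- y) :* con ½ := :- (y :* con ½)) refl y) ⟩
      negK (x ℚ.+ y ℚ.* -½ +i√3 y ℚ.* ½)
        ≡⟨ cong negK (κ-coeffs x y) ⟨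
      negK (κ x y) ∎

    κ-conj : ∀ x y → κ (x ℚ.- y) (ℚ.- y) ≡ conjK (κ x y)
    κ-conj x y = begin
      κ (x ℚ.- y) (ℚ.- y)
        ≡⟨ κ-coeffs (x ℚ.- y) (ℚ.- y) ⟩
      ((x ℚ.- y) ℚ.+ (ℚ.- y) ℚ.* -½ +i√3 (ℚ.- y) ℚ.* ½)
        ≡⟨ K-≡
          (solve 2 (λ x y → (x :- y) :+ (:- y) :* con -½ := x :+ y :* con -½) refl x y)
          (solve 1 (λ y → (:- y) :* con ½ := :- (y :* con ½)) refl y) ⟩
      conjK (x ℚ.+ y ℚ.* -½ +i√3 y ℚ.* ½)
        ≡⟨ cong conjK (κ-coeffs x y) ⟨
      conjK (κ x y) ∎

    ι-+ : ∀ α β → ι (α + β) ≡ addK (ι α) (ι β)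
    ι-+ ⟨ a , b ⟩ ⟨ c , d ⟩ =
      trans (cong₂ κ (ofℤ-+ a c) (ofℤ-+ b d)) (κ-+ (ofℤ a) (ofℤ b) (ofℤ c) (ofℤ d))

    ι-* : ∀ α β → ι (α * β) ≡ mulK (ι α) (ι β)
    ι-* ⟨ a , b ⟩ ⟨ c , d ⟩ = trans
      (cong₂ κ
        (trans (ofℤ-sub (a ℤ.* c) (b ℤ.* d)) (cong₂ ℚ._-_ (ofℤ-* a c) (ofℤ-* b d)))
        (trans (ofℤ-sub (a ℤ.* d ℤ.+ b ℤ.* c) (b ℤ.* d))
          (cong₂ ℚ._-_
            (trans (ofℤ-+ (a ℤ.* d) (b ℤ.* c)) (cong₂ ℚ._+_ (ofℤ-* a d) (ofℤ-* b c)))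
            (ofℤ-* b d))))
      (κ-* (ofℤ a) (ofℤ b) (ofℤ c) (ofℤ d))

    ι-neg : ∀ α → ι (- α) ≡ negK (ι α)
    ι-neg ⟨ a , b ⟩ = trans (cong₂ κ (ofℤ-neg a) (ofℤ-neg b)) (κ-neg (ofℤ a) (ofℤ b))

    ι-injective : ∀ {α β} → ι α ≡ ι β → α ≡ β
    ι-injective {⟨ a , b ⟩} {⟨ c , d ⟩} eq = D-≡ (ofℤ-injective a≡c) (ofℤ-injective b≡d)
      where
      coeffs-eq : (ofℤ a ℚ.+ ofℤ b ℚ.* -½ +i√3 ofℤ b ℚ.* ½)
                ≡ (ofℤ c ℚ.+ ofℤ d ℚ.* -½ +i√3 ofℤ d ℚ.* ½)
      coeffs-eq = trans (sym (κ-coeffs (ofℤ a) (ofℤ b)))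
                        (trans eq (κ-coeffs (ofℤ c) (ofℤ d)))
      first : ∀ x y → (x ℚ.+ y ℚ.* -½) ℚ.+ y ℚ.* ½ ≡ x
      first = solve 2 (λ x y → (x :+ y :* con -½) :+ y :* con ½ := x) refl
      second : ∀ y → y ℚ.* ½ ℚ.+ y ℚ.* ½ ≡ y
      second = solve 1 (λ y → y :* con ½ :+ y :* con ½ := y) refl
      a≡c : ofℤ a ≡ ofℤ c
      a≡c = trans (sym (first (ofℤ a) (ofℤ b)))
        (trans (cong (λ z → K.rat z ℚ.+ K.irr z) coeffs-eq) (first (ofℤ c) (ofℤ d)))
      b≡d : ofℤ b ≡ ofℤ d
      b≡d = trans (sym (second (ofℤ b)))
        (trans (cong (λ z → K.irr z ℚ.+ K.irr z) coeffs-eq) (second (ofℤ d)))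

  ι-ω : ι ω ≡ ωK
  ι-ω = refl

  ι-conj : ∀ α → ι (conj α) ≡ conjK (ι α)
  ι-conj ⟨ a , b ⟩ =
    trans (cong₂ κ (ofℤ-sub a b) (ofℤ-neg b)) (κ-conj (ofℤ a) (ofℤ b))

  ι-isRingMonomorphism :
    IsRingMonomorphism (CommutativeRing.rawRing +-*-commutativeRing) K-rawRing ι
  ι-isRingMonomorphism = record
    { isRingHomomorphism = record
      { isSemiringHomomorphism = record
        { isNearSemiringHomomorphism = record
          { +-isMonoidHomomorphism = record
            { isMagmaHomomorphism = record
              { isRelHomomorphism = record { cong = cong ι }
              ; homo = ι-+ }
            ; ε-homo = refl }
          ; *-homo = ι-* }
        ; 1#-homo = refl }
      ; -‿homo = ι-neg }
    ; injective = ι-injective }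

{-# OPTIONS --safe #-}
-- The norm is multiplicative, so a unit has norm ±1, and α * conj α = N α
-- gives the converse.  The identity 4 N(a + bω) = (2a - b)² + 3b² excludes
-- norm -1 and forces |b| ≤ 1 when the norm is 1; the norm is symmetric in a
-- and b, which leaves nine elements to inspect.
module Submission where

open import Defs
open import Algebra.Bundles using (module CommutativeRing)
open import Data.Integer using (ℤ; +_; -[1+_]; 0ℤ; 1ℤ; ∣_∣)
import Data.Integer as ℤ
import Data.Integer.Properties as ℤ
open import Data.Integer.Tactic.RingSolver using (solve-∀)
open import Data.List using (_∷_; [])
open import Data.List.Membership.Propositional using (_∈_)
open import Data.List.Relation.Unary.Any using (here; there)
import Data.Nat as ℕ
import Data.Nat.Properties as ℕ
open import Data.Product using (_×_; _,_)
open import Function.Base using (_∘_)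
open import Function.Bundles using (_⇔_; mk⇔)
open import Relation.Binary.PropositionalEquality
  using (_≡_; refl; sym; trans; cong; cong₂; module ≡-Reasoning)
open import Relation.Nullary.Decidable using (from-no)
open import Relation.Nullary.Negation using (contradiction)

open CommutativeRing +-*-commutativeRing using (*-comm)

N-homo-* : ∀ α β → N (α * β) ≡ N α ℤ.* N β
N-homo-* ⟨ a , b ⟩ ⟨ c , d ⟩ = p a b c d
  where
  p : ∀ a b c d →
      (a ℤ.* c ℤ.- b ℤ.* d) ℤ.* (a ℤ.* c ℤ.- b ℤ.* d)
        ℤ.- (a ℤ.* c ℤ.- b ℤ.* d) ℤ.* (a ℤ.* d ℤ.+ b ℤ.* c ℤ.- b ℤ.* d)
        ℤ.+ (a ℤ.* d ℤ.+ b ℤ.* c ℤ.- b ℤ.* d) ℤ.* (a ℤ.* d ℤ.+ b ℤ.* c ℤ.- b ℤ.* d)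
    ≡ (a ℤ.* a ℤ.- a ℤ.* b ℤ.+ b ℤ.* b) ℤ.* (c ℤ.* c ℤ.- c ℤ.* d ℤ.+ d ℤ.* d)
  p = solve-∀

N-swap : ∀ a b → N ⟨ a , b ⟩ ≡ N ⟨ b , a ⟩
N-swap = p
  where
  p : ∀ a b → a ℤ.* a ℤ.- a ℤ.* b ℤ.+ b ℤ.* b ≡ b ℤ.* b ℤ.- b ℤ.* a ℤ.+ a ℤ.* a
  p = solve-∀

i*i≡+∣i∣*∣i∣ : ∀ i → i ℤ.* i ≡ + (∣ i ∣ ℕ.* ∣ i ∣)
i*i≡+∣i∣*∣i∣ (+ n)    = sym (ℤ.pos-* n n)
i*i≡+∣i∣*∣i∣ -[1+ n ] = refl

-- Completing the square. Writing the result as `+_` of a natural number makes nonnegativity visible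
-- to pattern matching and lets the size estimate be carried out in `ℕ`.
4*N : ∀ a b → + 4 ℤ.* N ⟨ a , b ⟩
            ≡ + (∣ + 2 ℤ.* a ℤ.- b ∣ ℕ.* ∣ + 2 ℤ.* a ℤ.- b ∣ ℕ.+ 3 ℕ.* (∣ b ∣ ℕ.* ∣ b ∣))
4*N a b = begin
  + 4 ℤ.* N ⟨ a , b ⟩
    ≡⟨ p a b ⟩
  c ℤ.* c ℤ.+ + 3 ℤ.* (b ℤ.* b)
    ≡⟨ cong₂ (λ x y → x ℤ.+ + 3 ℤ.* y) (i*i≡+∣i∣*∣i∣ c) (i*i≡+∣i∣*∣i∣ b) ⟩
  + (∣ c ∣ ℕ.* ∣ c ∣) ℤ.+ + 3 ℤ.* + (∣ b ∣ ℕ.* ∣ b ∣)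
    ≡⟨ cong (λ x → + (∣ c ∣ ℕ.* ∣ c ∣) ℤ.+ x) (ℤ.pos-* 3 (∣ b ∣ ℕ.* ∣ b ∣)) ⟨
  + (∣ c ∣ ℕ.* ∣ c ∣ ℕ.+ 3 ℕ.* (∣ b ∣ ℕ.* ∣ b ∣)) ∎
  where
  open ≡-Reasoning
  c = + 2 ℤ.* a ℤ.- b
  p : ∀ a b → + 4 ℤ.* (a ℤ.* a ℤ.- a ℤ.* b ℤ.+ b ℤ.* b)
            ≡ (+ 2 ℤ.* a ℤ.- b) ℤ.* (+ 2 ℤ.* a ℤ.- b) ℤ.+ + 3 ℤ.* (b ℤ.* b)
  p = solve-∀

-- A negative norm would make the left side of `4*N` reduce to a negative integer, while the right
-- side is headed by `+_`.
+∣N∣≡N : ∀ α → + ∣ N α ∣ ≡ N α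
+∣N∣≡N ⟨ a , b ⟩ with N ⟨ a , b ⟩ | 4*N a b
... | + _      | _  = refl
... | -[1+ _ ] | ()

IsUnit⇒N≡1 : ∀ α → IsUnit α → N α ≡ 1ℤ
IsUnit⇒N≡1 α (β , _ , αβ≡1) = trans (sym (+∣N∣≡N α))
  -- Absolute values turn `N α ℤ.* N β ≡ 1ℤ` into a factorisation of 1 in `ℕ`; nonnegativity of the
  -- norm then restores the sign.
  (cong +_ (ℕ.m*n≡1⇒m≡1 ∣ N α ∣ ∣ N β ∣ ∣Nα∣*∣Nβ∣≡1))
  where
  ∣Nα∣*∣Nβ∣≡1 : ∣ N α ∣ ℕ.* ∣ N β ∣ ≡ 1
  ∣Nα∣*∣Nβ∣≡1 = trans (sym (ℤ.abs-* (N α) (N β)))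
    (cong ∣_∣ (trans (sym (N-homo-* α β)) (cong N αβ≡1)))

N≡1⇒IsUnit : ∀ α → N α ≡ 1ℤ → IsUnit α
N≡1⇒IsUnit α Nα≡1 = conj α , trans (*-comm (conj α) α) α*conjα≡1 , α*conjα≡1
  where
  α*conjα≡1 : α * conj α ≡ 1#
  α*conjα≡1 = trans (α*conjα≡Nα α) (cong fromℤ Nα≡1)

N≡1⇒∣coeffω∣≤1 : ∀ a b → N ⟨ a , b ⟩ ≡ 1ℤ → ∣ b ∣ ℕ.≤ 1
N≡1⇒∣coeffω∣≤1 a b N≡1 = ℕ.≮⇒≥ λ 2≤∣b∣ → contradiction (12≤4 2≤∣b∣) (from-no (12 ℕ.≤? 4))
  where
  open ℕ.≤-Reasoning
  c² = ∣ + 2 ℤ.* a ℤ.- b ∣ ℕ.* ∣ + 2 ℤ.* a ℤ.- b ∣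
  12≤4 : 2 ℕ.≤ ∣ b ∣ → 12 ℕ.≤ 4
  12≤4 2≤∣b∣ = begin
    -- Here 12 is 3 · 2 · 2, and the final 4 is four times the norm.
    12                              ≤⟨ ℕ.*-monoʳ-≤ 3 (ℕ.*-mono-≤ 2≤∣b∣ 2≤∣b∣) ⟩
    3 ℕ.* (∣ b ∣ ℕ.* ∣ b ∣)          ≤⟨ ℕ.m≤n+m _ c² ⟩
    c² ℕ.+ 3 ℕ.* (∣ b ∣ ℕ.* ∣ b ∣)   ≡⟨ ℤ.+-injective (trans (sym (4*N a b)) (cong (+ 4 ℤ.*_) N≡1)) ⟩
    4                               ∎

N≡1⇒∣coeff₁∣≤1 : ∀ a b → N ⟨ a , b ⟩ ≡ 1ℤ → ∣ a ∣ ℕ.≤ 1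
N≡1⇒∣coeff₁∣≤1 a b N≡1 = N≡1⇒∣coeffω∣≤1 b a (trans (N-swap b a) N≡1)

-- Indexing by the integer lets a match replace both coefficients by literals, so that norms and
-- list entries compute.
data SmallInteger : ℤ → Set where
  -1′ : SmallInteger -[1+ 0 ]
  0′  : SmallInteger 0ℤ
  1′  : SmallInteger 1ℤ

small : ∀ i → ∣ i ∣ ℕ.≤ 1 → SmallInteger i
small (+ 0)    _ = 0′
small (+ 1)    _ = 1′
small -[1+ 0 ] _ = -1′
small (+ ℕ.suc (ℕ.suc _)) (ℕ.s≤s ())
small -[1+ ℕ.suc _ ]      (ℕ.s≤s ())

N≡1⇒∈ : ∀ α → N α ≡ 1ℤ → α ∈ 1# ∷ (- 1#) ∷ ω ∷ (- ω) ∷ (ω ^ 2) ∷ (- (ω ^ 2)) ∷ []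
N≡1⇒∈ ⟨ a , b ⟩ N≡1
  with small a (N≡1⇒∣coeff₁∣≤1 a b N≡1) | small b (N≡1⇒∣coeffω∣≤1 a b N≡1) | N≡1
... | 1′  | 0′  | _ = here refl
... | -1′ | 0′  | _ = there (here refl)
... | 0′  | 1′  | _ = there (there (here refl))
... | 0′  | -1′ | _ = there (there (there (here refl)))
-- `ω ^ 2` evaluates to -1 - ω.
... | -1′ | -1′ | _ = there (there (there (there (here refl))))
... | 1′  | 1′  | _ = there (there (there (there (there (here refl)))))
-- The three remaining elements have norms 0, 3 and 3.
... | 0′  | 0′  | ()
... | 1′  | -1′ | ()
... | -1′ | 1′  | ()

-- Computing six norms spares exhibiting six inverses: `N≡1⇒IsUnit` supplies the conjugate each
-- time.
∈⇒N≡1 : ∀ α → α ∈ 1# ∷ (- 1#) ∷ ω ∷ (- ω) ∷ (ω ^ 2) ∷ (- (ω ^ 2)) ∷ [] → N α ≡ 1ℤ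
∈⇒N≡1 _ (here refl)                                         = refl
∈⇒N≡1 _ (there (here refl))                                 = refl
∈⇒N≡1 _ (there (there (here refl)))                         = refl
∈⇒N≡1 _ (there (there (there (here refl))))                 = refl
∈⇒N≡1 _ (there (there (there (there (here refl)))))         = refl
∈⇒N≡1 _ (there (there (there (there (there (here refl)))))) = refl

proposition3p1 : (∀ (α : D) → IsUnit α ⇔ (N α ≡ 1ℤ)) ×
    (∀ (α : D) → IsUnit α ⇔ (α ∈ 1# ∷ (- 1#) ∷ ω ∷ (- ω) ∷ (ω ^ 2) ∷ (- (ω ^ 2)) ∷ []))
proposition3p1 =
    (λ α → mk⇔ (IsUnit⇒N≡1 α) (N≡1⇒IsUnit α))
  , (λ α → mk⇔ (N≡1⇒∈ α ∘ IsUnit⇒N≡1 α) (N≡1⇒IsUnit α ∘ ∈⇒N≡1 α))
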